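{- $\text{\ss}_i \geq \mathbf{cov}(\mathcal{M})$, where $\text{\ss}_i$ is the subseries number for divergence to $\pm\infty$ and $\mathbf{cov}(\mathcal{M})$ is the covering number for Baire category.
   Context: $\mathbb{N}=\{1,2,3,\dots\}$. For $A\subseteq\mathbb{N}$, the subseries $\sum_{n\in A}a_n$ is summed in increasing order of the indices. A series is conditionally convergent if it converges but not absolutely. $\text{\ss}_i$ is the smallest cardinality of a family $\mathcal{A}$ of subsets of $\mathbb{N}$ such that for every conditionally convergent series $\sum_{n\in\mathbb{N}}a_n$ of real numbers there is $A\in\mathcal{A}$ such that $\sum_{n\in A}a_n$ diverges to $+\infty$ or diverges to $-\infty$. $\mathbf{cov}(\mathcal{M})$ is the minimum cardinality of a family of meager subsets of the Cantor space $2^{\mathbb{N}}$ whose union is $2^{\mathbb{N}}$. -}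

module Defs where

open import Data.Bool using (Bool; true; if_then_else_)
open import Data.Nat as ℕ using (ℕ; zero; suc)
import Data.Nat.Properties as ℕ
open import Data.Product using (Σ-syntax; ∃-syntax; _×_; _,_)
open import Data.Rational as ℚ using (ℚ; 0ℚ; ½)
import Data.Rational.Properties as ℚ
open import Data.Rational.Solver using (module +-*-Solver)
open import Data.Sum using (_⊎_; inj₁; inj₂)
open import Function.Bundles using (_↣_)
open import Function.Definitions using (Injective)
open import Level using (0ℓ; _⊔_) renaming (suc to lsuc)
open import Relation.Binary.Bundles using (Setoid)
open import Relation.Binary.PropositionalEquality
  using (_≡_; _≗_; refl; sym; trans; cong; subst)
open import Relation.Nullary using (¬_)
open import Relation.Unary using (Pred; Empty; Universal; ⋃; _≐_)

------------------------------------------------------------------------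
-- Choice

-- Every equivalence relation has a system of representatives.  Unlike
-- the Σ-type form ∀∃ → ∃∀, which is provable, this is not derivable in
-- type theory: it is Zermelo's axiom of choice for sets.
AxiomOfChoice : Set₁
AxiomOfChoice = (S : Setoid 0ℓ 0ℓ) → let open Setoid S in
  Σ[ rep ∈ (Carrier → Carrier) ]
    (∀ x → rep x ≈ x) × (∀ {x y} → x ≈ y → rep x ≡ rep y)

------------------------------------------------------------------------
-- Real numbers, as Cauchy sequences of rationals
--
-- Two sequences may represent the same real.  No quotient is taken: every
-- notion below depends only on the reals represented.

IsCauchy : (ℕ → ℚ) → Set
IsCauchy x = ∀ ε → 0ℚ ℚ.< ε →
  ∃[ N ] ∀ m n → N ℕ.≤ m → N ℕ.≤ n → ℚ.∣ x m ℚ.- x n ∣ ℚ.< ε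

record ℝ : Set where
  constructor mkℝ
  field
    approx : ℕ → ℚ
    cauchy : IsCauchy approx

open ℝ public

private
  half-pos : ∀ {ε} → 0ℚ ℚ.< ε → 0ℚ ℚ.< ½ ℚ.* ε
  half-pos = ℚ.*-monoʳ-<-pos ½

  half+half : ∀ ε → ½ ℚ.* ε ℚ.+ ½ ℚ.* ε ≡ ε
  half+half = solve 1 (λ e → con ½ :* e :+ con ½ :* e := e) refl
    where open +-*-Solver

  interchange : ∀ a b c d →
    (a ℚ.+ b) ℚ.- (c ℚ.+ d) ≡ (a ℚ.- c) ℚ.+ (b ℚ.- d)
  interchange = solve 4 (λ a b c d →
    (a :+ b) :- (c :+ d) := (a :- c) :+ (b :- d)) refl
    where open +-*-Solver

  ∣p-q∣≡∣q-p∣ : ∀ p q → ℚ.∣ p ℚ.- q ∣ ≡ ℚ.∣ q ℚ.- p ∣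
  ∣p-q∣≡∣q-p∣ p q = trans
    (cong ℚ.∣_∣ (solve 2 (λ p q → p :- q := :- (q :- p)) refl p q))
    (ℚ.∣-p∣≡∣p∣ (q ℚ.- p))
    where open +-*-Solver

  ∣p∣-∣q∣≤∣p-q∣ : ∀ p q → ℚ.∣ p ∣ ℚ.- ℚ.∣ q ∣ ℚ.≤ ℚ.∣ p ℚ.- q ∣
  ∣p∣-∣q∣≤∣p-q∣ p q = begin
    ℚ.∣ p ∣ ℚ.- ℚ.∣ q ∣
      ≡⟨ cong (λ r → ℚ.∣ r ∣ ℚ.- ℚ.∣ q ∣)
           (solve 2 (λ p q → p := (p :- q) :+ q) refl p q) ⟩
    ℚ.∣ (p ℚ.- q) ℚ.+ q ∣ ℚ.- ℚ.∣ q ∣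
      ≤⟨ ℚ.+-monoˡ-≤ (ℚ.- ℚ.∣ q ∣) (ℚ.∣p+q∣≤∣p∣+∣q∣ (p ℚ.- q) q) ⟩
    (ℚ.∣ p ℚ.- q ∣ ℚ.+ ℚ.∣ q ∣) ℚ.- ℚ.∣ q ∣
      ≡⟨ solve 2 (λ a b → (a :+ b) :- b := a) refl ℚ.∣ p ℚ.- q ∣ ℚ.∣ q ∣ ⟩
    ℚ.∣ p ℚ.- q ∣ ∎
    where
    open ℚ.≤-Reasoning
    open +-*-Solver

  ∣∣p∣-∣q∣∣≤∣p-q∣ : ∀ p q → ℚ.∣ ℚ.∣ p ∣ ℚ.- ℚ.∣ q ∣ ∣ ℚ.≤ ℚ.∣ p ℚ.- q ∣
  ∣∣p∣-∣q∣∣≤∣p-q∣ p q with ℚ.∣p∣≡p∨∣p∣≡-p (ℚ.∣ p ∣ ℚ.- ℚ.∣ q ∣)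
  ... | inj₁ eq = subst (ℚ._≤ ℚ.∣ p ℚ.- q ∣) (sym eq) (∣p∣-∣q∣≤∣p-q∣ p q)
  ... | inj₂ eq = begin
    ℚ.∣ ℚ.∣ p ∣ ℚ.- ℚ.∣ q ∣ ∣   ≡⟨ eq ⟩
    ℚ.- (ℚ.∣ p ∣ ℚ.- ℚ.∣ q ∣)
      ≡⟨ solve 2 (λ a b → :- (a :- b) := b :- a) refl ℚ.∣ p ∣ ℚ.∣ q ∣ ⟩
    ℚ.∣ q ∣ ℚ.- ℚ.∣ p ∣         ≤⟨ ∣p∣-∣q∣≤∣p-q∣ q p ⟩
    ℚ.∣ q ℚ.- p ∣               ≡⟨ ∣p-q∣≡∣q-p∣ q p ⟩
    ℚ.∣ p ℚ.- q ∣               ∎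
    where
    open ℚ.≤-Reasoning
    open +-*-Solver

0ℝ : ℝ
0ℝ = mkℝ (λ _ → 0ℚ) (λ ε 0<ε → 0 , λ _ _ _ _ → 0<ε)

infixl 6 _+_ _-_
infix  8 -_
infix  4 _<_

_+_ : ℝ → ℝ → ℝ
approx (x + y) n = approx x n ℚ.+ approx y n
cauchy (x + y) ε 0<ε with cauchy x (½ ℚ.* ε) (half-pos 0<ε)
                        | cauchy y (½ ℚ.* ε) (half-pos 0<ε)
... | M , close-x | N , close-y = M ℕ.⊔ N , λ m n m≥ n≥ →
  let xm = approx x m; xn = approx x n; ym = approx y m; yn = approx y n in
  begin-strict
    ℚ.∣ (xm ℚ.+ ym) ℚ.- (xn ℚ.+ yn) ∣
      ≡⟨ cong ℚ.∣_∣ (interchange xm ym xn yn) ⟩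
    ℚ.∣ (xm ℚ.- xn) ℚ.+ (ym ℚ.- yn) ∣
      ≤⟨ ℚ.∣p+q∣≤∣p∣+∣q∣ (xm ℚ.- xn) (ym ℚ.- yn) ⟩
    ℚ.∣ xm ℚ.- xn ∣ ℚ.+ ℚ.∣ ym ℚ.- yn ∣
      <⟨ ℚ.+-mono-<
           (close-x m n (ℕ.m⊔n≤o⇒m≤o M N m≥) (ℕ.m⊔n≤o⇒m≤o M N n≥))
           (close-y m n (ℕ.m⊔n≤o⇒n≤o M N m≥) (ℕ.m⊔n≤o⇒n≤o M N n≥)) ⟩
    ½ ℚ.* ε ℚ.+ ½ ℚ.* ε
      ≡⟨ half+half ε ⟩
    ε ∎
  where open ℚ.≤-Reasoning

-_ : ℝ → ℝ
approx (- x) n = ℚ.- approx x n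
cauchy (- x) ε 0<ε with cauchy x ε 0<ε
... | N , close = N , λ m n m≥ n≥ →
  subst (ℚ._< ε)
    (cong ℚ.∣_∣ (solve 2 (λ a b → b :- a := (:- a) :- (:- b)) refl
      (approx x m) (approx x n)))
    (close n m n≥ m≥)
  where open +-*-Solver

_-_ : ℝ → ℝ → ℝ
x - y = x + - y

∣_∣ : ℝ → ℝ
approx ∣ x ∣ n = ℚ.∣ approx x n ∣
cauchy ∣ x ∣ ε 0<ε with cauchy x ε 0<ε
... | N , close = N , λ m n m≥ n≥ →
  ℚ.≤-<-trans (∣∣p∣-∣q∣∣≤∣p-q∣ (approx x m) (approx x n)) (close m n m≥ n≥)

-- The gap δ is needed: eventual strict inequality of the approximations
-- would only give x ≤ y.
_<_ : ℝ → ℝ → Set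
x < y = ∃[ δ ] 0ℚ ℚ.< δ ×
  (∃[ N ] ∀ n → N ℕ.≤ n → approx x n ℚ.+ δ ℚ.≤ approx y n)

------------------------------------------------------------------------
-- Series and subseries

-- Terms are indexed from 0, so a n stands for the (n+1)-st term.
Series : Set
Series = ℕ → ℝ

ConvergesTo : (ℕ → ℝ) → ℝ → Set
ConvergesTo s l = ∀ ε → 0ℝ < ε → ∃[ N ] ∀ n → N ℕ.≤ n → ∣ s n - l ∣ < ε

DivergesTo+∞ : (ℕ → ℝ) → Set
DivergesTo+∞ s = ∀ b → ∃[ N ] ∀ n → N ℕ.≤ n → b < s n

DivergesTo-∞ : (ℕ → ℝ) → Set
DivergesTo-∞ s = ∀ b → ∃[ N ] ∀ n → N ℕ.≤ n → s n < b

-- Subsets of ℕ are given by characteristic functions and compared by _≗_.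
Subset : Set
Subset = ℕ → Bool

-- partialSum A a n is the sum of a k over the k ∈ A with k < n.
partialSum : Subset → Series → ℕ → ℝ
partialSum A a zero    = 0ℝ
partialSum A a (suc n) =
  if A n then partialSum A a n + a n else partialSum A a n

Convergent : Series → Set
Convergent a = ∃[ l ] ConvergesTo (partialSum (λ _ → true) a) l

ConditionallyConvergent : Series → Set
ConditionallyConvergent a = Convergent a × ¬ Convergent (λ n → ∣ a n ∣)

SubseriesDivergesTo±∞ : Subset → Series → Set
SubseriesDivergesTo±∞ A a =
  DivergesTo+∞ (partialSum A a) ⊎ DivergesTo-∞ (partialSum A a)

------------------------------------------------------------------------
-- Baire category in the Cantor space

Cantor : Set
Cantor = ℕ → Bool

-- The basic neighbourhoods of x in the product topology.
Ball : Cantor → ℕ → Pred Cantor 0ℓ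
Ball x n y = ∀ k → k ℕ.< n → y k ≡ x k

Closure : Pred Cantor 0ℓ → Pred Cantor 0ℓ
Closure P x = ∀ n → ∃[ y ] Ball x n y × P y

Interior : Pred Cantor 0ℓ → Pred Cantor 0ℓ
Interior P x = ∃[ n ] ∀ y → Ball x n y → P y

NowhereDense : Pred Cantor 0ℓ → Set
NowhereDense P = Empty (Interior (Closure P))

Meager : Pred Cantor 0ℓ → Set₁
Meager P = Σ[ N ∈ (ℕ → Pred Cantor 0ℓ) ] (∀ n → NowhereDense (N n)) × P ≐ ⋃ ℕ N

------------------------------------------------------------------------
-- Cardinal invariants
--
-- A family of cardinality K is one enumerated without repetition by the
-- type K, and K ↣ L expresses that K is at most L in cardinality.

IsLeastCardinality : ∀ {ℓ} → (Set → Set ℓ) → Set → Set (lsuc 0ℓ ⊔ ℓ)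
IsLeastCardinality P K = P K × (∀ L → P L → K ↣ L)

SubseriesFamily : Set → Set
SubseriesFamily K = Σ[ 𝒜 ∈ (K → Subset) ] Injective _≡_ _≗_ 𝒜 ×
  (∀ a → ConditionallyConvergent a → ∃[ k ] SubseriesDivergesTo±∞ (𝒜 k) a)

MeagerCover : Set → Set₁
MeagerCover K = Σ[ ℳ ∈ (K → Pred Cantor 0ℓ) ] Injective _≡_ _≐_ ℳ ×
  (∀ k → Meager (ℳ k)) × Universal (⋃ K ℳ)

Is-ßᵢ : Set → Set₁
Is-ßᵢ = IsLeastCardinality SubseriesFamily

Is-cov[𝓜] : Set → Set₁
Is-cov[𝓜] = IsLeastCardinality MeagerCover

{-# OPTIONS --safe #-}

-- Fix a null sequence C of unbounded variation.  A point x of the Cantor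
-- space codes the series that runs through the increments of C, in order, at
-- the places where x is true and is 0 elsewhere; it converges conditionally
-- unless x is eventually false.  If A is eventually constant, then no coded
-- series diverges to ±∞ along A.  Otherwise any initial segment of x can be
-- extended by placing the negative increments on A and the others off A, which
-- drives the partial sums along A below 0; dually for the positive increments.
-- Hence the set of x whose series diverges to ±∞ along A is meager, and a
-- family of subsets witnessing ßᵢ yields at most as many meager sets covering
-- the Cantor space.
module Submission where

open import Defs
open import Axiom.ExcludedMiddle using (ExcludedMiddle)
open import Data.Product using (∃-syntax; _×_)
open import Function.Bundles using (_↣_)
open import Level using (0ℓ)

open import Axiom.UniquenessOfIdentityProofs.WithK using (uip)
open import Data.Bool using (Bool; true; false; not; if_then_else_)
import Data.Bool.Properties as Bool
open import Data.Integer as ℤ using (+_; -[1+_])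
import Data.Integer.Properties as ℤ
open import Data.Integer.Solver using () renaming (module +-*-Solver to ℤ-Solver)
open import Data.Nat as ℕ using (ℕ; zero; suc)
import Data.Nat.Properties as ℕ
open import Data.Nat.Tactic.RingSolver using (solve-∀)
open import Data.Product using (Σ-syntax; _,_; proj₁; proj₂)
open import Data.Rational as ℚ using (ℚ; mkℚ; 0ℚ; 1ℚ; ½; toℚᵘ)
import Data.Rational.Properties as ℚ
open import Data.Rational.Solver using (module +-*-Solver)
open import Data.Rational.Unnormalised as ℚᵘ using (mkℚᵘ)
import Data.Rational.Unnormalised.Properties as ℚᵘ
open import Data.Sum using (_⊎_; inj₁; inj₂; [_,_]′)
open import Function using (_∘_; mk↣)
open import Function.Construct.Composition using (_↣-∘_)
open import Function.Definitions using (Injective)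
open import Relation.Binary.Core using (Rel)
import Relation.Binary.Construct.On as On
open import Relation.Binary.Definitions using (Reflexive; Transitive)
open import Relation.Binary.PropositionalEquality
  using (_≡_; refl; sym; trans; cong; cong₂; subst)
open import Relation.Nullary using (¬_; Dec; yes; no; does; contradiction)
open import Relation.Nullary.Decidable using (dec-true; dec-false; from-yes)
open import Relation.Unary using (Pred; Universal; ⋃; _≐_)
open import Relation.Unary.Properties using (≐-refl)
open import Relation.Unary.Relation.Binary.Equality using (≐-isEquivalence)

-- Fractions and the divergence of the harmonic series.

p≤q⇒p≯q : ∀ {p q} → p ℚ.≤ q → ¬ (q ℚ.< p)
p≤q⇒p≯q p≤q q<p = ℚ.<-irrefl refl (ℚ.<-≤-trans q<p p≤q)

/-mono-≤ : ∀ a b m n → a ℕ.* suc n ℕ.≤ b ℕ.* suc m →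
  + a ℚ./ suc m ℚ.≤ + b ℚ./ suc n
/-mono-≤ a b m n le = ℚ.toℚᵘ-cancel-≤ (begin
  toℚᵘ (+ a ℚ./ suc m)  ≃⟨ ℚ.toℚᵘ-fromℚᵘ (mkℚᵘ (+ a) m) ⟩
  mkℚᵘ (+ a) m          ≤⟨ ℚᵘ.*≤* cross ⟩
  mkℚᵘ (+ b) n          ≃⟨ ℚ.toℚᵘ-fromℚᵘ (mkℚᵘ (+ b) n) ⟨
  toℚᵘ (+ b ℚ./ suc n)  ∎)
  where
  open ℚᵘ.≤-Reasoning
  cross : + a ℤ.* + suc n ℤ.≤ + b ℤ.* + suc m
  cross = subst (ℤ._≤ + b ℤ.* + suc m) (ℤ.pos-* a (suc n))
    (subst (+ (a ℕ.* suc n) ℤ.≤_) (ℤ.pos-* b (suc m)) (ℤ.+≤+ le))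

/-+-/ : ∀ a b m → + a ℚ./ suc m ℚ.+ + b ℚ./ suc m ≡ + (a ℕ.+ b) ℚ./ suc m
/-+-/ a b m = ℚ.toℚᵘ-injective (begin
  toℚᵘ (+ a ℚ./ suc m ℚ.+ + b ℚ./ suc m)
    ≈⟨ ℚ.toℚᵘ-homo-+ (+ a ℚ./ suc m) (+ b ℚ./ suc m) ⟩
  toℚᵘ (+ a ℚ./ suc m) ℚᵘ.+ toℚᵘ (+ b ℚ./ suc m)
    ≈⟨ ℚᵘ.+-cong (ℚ.toℚᵘ-fromℚᵘ (mkℚᵘ (+ a) m)) (ℚ.toℚᵘ-fromℚᵘ (mkℚᵘ (+ b) m)) ⟩
  mkℚᵘ (+ a) m ℚᵘ.+ mkℚᵘ (+ b) m
    ≈⟨ ℚᵘ.*≡* (cross (+ a) (+ b) (+ suc m)) ⟩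
  mkℚᵘ (+ (a ℕ.+ b)) m
    ≈⟨ ℚ.toℚᵘ-fromℚᵘ (mkℚᵘ (+ (a ℕ.+ b)) m) ⟨
  toℚᵘ (+ (a ℕ.+ b) ℚ./ suc m) ∎)
  where
  open import Relation.Binary.Reasoning.Setoid ℚᵘ.≃-setoid
  cross : ∀ a b d → (a ℤ.* d ℤ.+ b ℤ.* d) ℤ.* d ≡ (a ℤ.+ b) ℤ.* (d ℤ.* d)
  cross = solve 3 (λ a b d → (a :* d :+ b :* d) :* d := (a :+ b) :* (d :* d)) refl
    where open ℤ-Solver

unitFraction : ℕ → ℚ
unitFraction k = + 1 ℚ./ suc k

unitFraction-antitone : ∀ {k l} → k ℕ.≤ l → unitFraction l ℚ.≤ unitFraction k
unitFraction-antitone {k} {l} k≤l = /-mono-≤ 1 1 l k (ℕ.*-monoʳ-≤ 1 (ℕ.s≤s k≤l))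

unitFraction-nonNegative : ∀ k → 0ℚ ℚ.≤ unitFraction k
unitFraction-nonNegative k = /-mono-≤ 0 1 0 k ℕ.z≤n

unitFraction-null : ∀ ε → 0ℚ ℚ.< ε → ∃[ k ] unitFraction k ℚ.≤ ε
unitFraction-null ε@(mkℚ (+ 0) d _) (ℚ.*<* (ℤ.+<+ ()))
unitFraction-null ε@(mkℚ (+ suc n) d _) _ = d , (begin
  + 1 ℚ./ suc d      ≤⟨ /-mono-≤ 1 (suc n) d d (ℕ.*-monoˡ-≤ (suc d) {1} {suc n} (ℕ.s≤s ℕ.z≤n)) ⟩
  + suc n ℚ./ suc d  ≡⟨ ℚ.fromℚᵘ-toℚᵘ ε ⟩
  ε                  ∎)
  where open ℚ.≤-Reasoning
unitFraction-null ε@(mkℚ -[1+ _ ] d _) (ℚ.*<* ())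

≤-halves : ∀ b → ∃[ n ] b ℚ.≤ + n ℚ./ 2
≤-halves b@(mkℚ (+ n) d _) = n ℕ.* 2 , (begin
  b                   ≡⟨ ℚ.fromℚᵘ-toℚᵘ b ⟨
  + n ℚ./ suc d       ≤⟨ /-mono-≤ n (n ℕ.* 2) d 1 (ℕ.m≤m*n (n ℕ.* 2) (suc d)) ⟩
  + (n ℕ.* 2) ℚ./ 2   ∎)
  where open ℚ.≤-Reasoning
≤-halves b@(mkℚ -[1+ n ] d _) = 0 , ℚ.*≤* ℤ.-≤+

-- Mirrors `partialSum` on rational terms; `approx-partialSum` identifies the two and so reduces
-- most of the argument to rational arithmetic.
sumOver : Subset → (ℕ → ℚ) → ℕ → ℚ
sumOver A f zero    = 0ℚ
sumOver A f (suc n) = if A n then sumOver A f n ℚ.+ f n else sumOver A f n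

total : (ℕ → ℚ) → ℕ → ℚ
total = sumOver (λ _ → true)

total-mono : ∀ {f g} → (∀ k → f k ℚ.≤ g k) → ∀ n → total f n ℚ.≤ total g n
total-mono f≤g zero    = ℚ.≤-refl
total-mono f≤g (suc n) = ℚ.+-mono-≤ (total-mono f≤g n) (f≤g n)

-- The sum starts at 1/2, to match the lower bound in `zigzag-increment`.
harmonic : ℕ → ℚ
harmonic = total (unitFraction ∘ suc)

-- 1/(k+2) + ⋯ + 1/(k+r+1) has r terms, the last one being the least.
harmonic-increase : ∀ k r → harmonic k ℚ.+ + r ℚ./ suc (r ℕ.+ k) ℚ.≤ harmonic (r ℕ.+ k)
harmonic-increase k zero = begin
  harmonic k ℚ.+ + 0 ℚ./ suc k  ≤⟨ ℚ.+-monoʳ-≤ (harmonic k) (/-mono-≤ 0 0 k 0 ℕ.z≤n) ⟩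
  harmonic k ℚ.+ 0ℚ             ≡⟨ ℚ.+-identityʳ (harmonic k) ⟩
  harmonic k                    ∎
  where open ℚ.≤-Reasoning
harmonic-increase k (suc r) = begin
  harmonic k ℚ.+ + suc r ℚ./ suc m
    ≡⟨ cong (λ n → harmonic k ℚ.+ + n ℚ./ suc m) (ℕ.+-comm 1 r) ⟩
  harmonic k ℚ.+ + (r ℕ.+ 1) ℚ./ suc m
    ≡⟨ cong (harmonic k ℚ.+_) (/-+-/ r 1 m) ⟨
  harmonic k ℚ.+ (+ r ℚ./ suc m ℚ.+ unitFraction m)
    ≡⟨ ℚ.+-assoc (harmonic k) _ _ ⟨
  harmonic k ℚ.+ + r ℚ./ suc m ℚ.+ unitFraction m
    ≤⟨ ℚ.+-monoˡ-≤ (unitFraction m) (ℚ.+-monoʳ-≤ (harmonic k)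
         (/-mono-≤ r r m (r ℕ.+ k) (ℕ.*-monoʳ-≤ r (ℕ.n≤1+n m)))) ⟩
  harmonic k ℚ.+ + r ℚ./ m ℚ.+ unitFraction m
    ≤⟨ ℚ.+-monoˡ-≤ (unitFraction m) (harmonic-increase k r) ⟩
  harmonic m ∎
  where
  open ℚ.≤-Reasoning
  m = suc (r ℕ.+ k)

-- Going from index k to 2k+1 adds k+1 terms, each at least 1/(2k+2), hence at least 1/2 in all.
harmonic-≥-halves : ∀ n → ∃[ k ] + n ℚ./ 2 ℚ.≤ harmonic k
harmonic-≥-halves zero = 0 , ℚ.≤-refl
harmonic-≥-halves (suc n) with harmonic-≥-halves n
... | k , n/2≤ = suc k ℕ.+ k , (begin
  + suc n ℚ./ 2
    ≡⟨ cong (λ n → + n ℚ./ 2) (ℕ.+-comm 1 n) ⟩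
  + (n ℕ.+ 1) ℚ./ 2
    ≡⟨ /-+-/ n 1 1 ⟨
  + n ℚ./ 2 ℚ.+ ½
    ≤⟨ ℚ.+-mono-≤ n/2≤ (/-mono-≤ 1 (suc k) 1 (suc k ℕ.+ k) (ℕ.≤-reflexive (double k))) ⟩
  harmonic k ℚ.+ + suc k ℚ./ suc (suc k ℕ.+ k)
    ≤⟨ harmonic-increase k (suc k) ⟩
  harmonic (suc k ℕ.+ k) ∎)
  where
  open ℚ.≤-Reasoning
  double : ∀ k → 1 ℕ.* suc (suc k ℕ.+ k) ≡ suc k ℕ.* 2
  double = solve-∀

harmonic-unbounded : ∀ b → ∃[ k ] b ℚ.≤ harmonic k
harmonic-unbounded b with ≤-halves b
... | n , b≤ with harmonic-≥-halves n
... | k , ≤H = k , ℚ.≤-trans b≤ ≤H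

-- Variation and descent of a rational sequence.

stepwise⇒monotone : ∀ {A : Set} (_∼_ : Rel A 0ℓ) → Reflexive _∼_ → Transitive _∼_ →
  ∀ (s : ℕ → A) → (∀ n → s n ∼ s (suc n)) → ∀ {m n} → m ℕ.≤ n → s m ∼ s n
stepwise⇒monotone _∼_ rfl trs s step m≤n = go (ℕ.≤⇒≤′ m≤n)
  where
  go : ∀ {m n} → m ℕ.≤′ n → s m ∼ s n
  go ℕ.≤′-refl       = rfl
  go (ℕ.≤′-step m≤n) = trs (go m≤n) (step _)

increment : (ℕ → ℚ) → ℕ → ℚ
increment C k = C (suc k) ℚ.- C k

variation : (ℕ → ℚ) → ℕ → ℚ
variation C = total (λ k → ℚ.∣ increment C k ∣)

-- Minus the negative variation in the Jordan decomposition of `C`.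
descent : (ℕ → ℚ) → ℕ → ℚ
descent C = total (λ k → increment C k ℚ.⊓ 0ℚ)

Bounded : (ℕ → ℚ) → Set
Bounded C = ∃[ β ] ∀ k l → C k ℚ.- C l ℚ.≤ β

UnboundedVariation : (ℕ → ℚ) → Set
UnboundedVariation C = ∀ b → ∃[ k ] b ℚ.≤ variation C k

UnboundedDescent : (ℕ → ℚ) → Set
UnboundedDescent C = ∀ b → ∃[ k ] descent C k ℚ.≤ b

total-increment : ∀ C n → total (increment C) n ≡ C n ℚ.- C 0
total-increment C zero    = sym (ℚ.+-inverseʳ (C 0))
total-increment C (suc n) = trans
  (cong (ℚ._+ increment C n) (total-increment C n))
  (solve 3 (λ x y z → (y :- x) :+ (z :- y) := z :- x) refl (C 0) (C n) (C (suc n)))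
  where open +-*-Solver

variation-mono : ∀ C {k l} → k ℕ.≤ l → variation C k ℚ.≤ variation C l
variation-mono C = stepwise⇒monotone ℚ._≤_ ℚ.≤-refl ℚ.≤-trans (variation C) λ n →
  subst (ℚ._≤ variation C (suc n)) (ℚ.+-identityʳ (variation C n))
    (ℚ.+-monoʳ-≤ (variation C n) (ℚ.0≤∣p∣ (increment C n)))

descent-antitone : ∀ C {k l} → k ℕ.≤ l → descent C l ℚ.≤ descent C k
descent-antitone C = stepwise⇒monotone ℚ._≥_ ℚ.≤-refl (λ p≥q q≥r → ℚ.≤-trans q≥r p≥q)
  (descent C) λ n →
  subst (descent C (suc n) ℚ.≤_) (ℚ.+-identityʳ (descent C n))
    (ℚ.+-monoʳ-≤ (descent C n) (ℚ.p⊓q≤q (increment C n) 0ℚ))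

∣p∣+2[p⊓0]≡p : ∀ p → ℚ.∣ p ∣ ℚ.+ (p ℚ.⊓ 0ℚ ℚ.+ p ℚ.⊓ 0ℚ) ≡ p
∣p∣+2[p⊓0]≡p p with ℚ.≤-total p 0ℚ
... | inj₁ p≤0 = trans
  (cong₂ (λ a m → a ℚ.+ (m ℚ.+ m))
    (trans (sym (ℚ.∣-p∣≡∣p∣ p)) (ℚ.0≤p⇒∣p∣≡p (ℚ.neg-antimono-≤ p≤0)))
    (ℚ.p≤q⇒p⊓q≡p p≤0))
  (solve 1 (λ p → :- p :+ (p :+ p) := p) refl p)
  where open +-*-Solver
... | inj₂ 0≤p = trans
  (cong₂ (λ a m → a ℚ.+ (m ℚ.+ m)) (ℚ.0≤p⇒∣p∣≡p 0≤p) (ℚ.p≥q⇒p⊓q≡q 0≤p))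
  (ℚ.+-identityʳ p)

variation+2descent : ∀ C n →
  variation C n ℚ.+ (descent C n ℚ.+ descent C n) ≡ C n ℚ.- C 0
variation+2descent C n = trans (collect n) (total-increment C n)
  where
  open +-*-Solver
  collect : ∀ n → variation C n ℚ.+ (descent C n ℚ.+ descent C n) ≡ total (increment C) n
  collect zero    = refl
  collect (suc n) = trans
    (solve 4 (λ v a d m → (v :+ a) :+ ((d :+ m) :+ (d :+ m)) := (v :+ (d :+ d)) :+ (a :+ (m :+ m)))
      refl (variation C n) ℚ.∣ increment C n ∣ (descent C n) (increment C n ℚ.⊓ 0ℚ))
    (cong₂ ℚ._+_ (collect n) (∣p∣+2[p⊓0]≡p (increment C n)))

-- By `variation+2descent`, twice the descent is a quantity at most β minus the variation. Variation
-- at least β - 2b therefore forces it down to 2b.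
descent-unbounded : ∀ C → Bounded C → UnboundedVariation C → UnboundedDescent C
descent-unbounded C (β , C≤β) unbounded b with unbounded (β ℚ.- (b ℚ.+ b))
... | k , large = k , ℚ.≮⇒≥ λ b<D → p≤q⇒p≯q (begin
  D ℚ.+ D
    ≡⟨ solve 2 (λ v e → e := (v :+ e) :- v) refl V (D ℚ.+ D) ⟩
  (V ℚ.+ (D ℚ.+ D)) ℚ.- V
    ≡⟨ cong (ℚ._- V) (variation+2descent C k) ⟩
  (C k ℚ.- C 0) ℚ.- V
    ≤⟨ ℚ.+-mono-≤ (C≤β k 0) (ℚ.neg-antimono-≤ large) ⟩
  β ℚ.- (β ℚ.- (b ℚ.+ b))
    ≡⟨ solve 2 (λ β e → β :- (β :- e) := e) refl β (b ℚ.+ b) ⟩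
  b ℚ.+ b ∎) (ℚ.+-mono-< b<D b<D)
  where
  open ℚ.≤-Reasoning
  open +-*-Solver
  V = variation C k
  D = descent C k

-- Series coded by points of the Cantor space.

count : Cantor → ℕ → ℕ
count x zero    = 0
count x (suc n) = if x n then suc (count x n) else count x n

count-step : ∀ x n → count x n ℕ.≤ count x (suc n)
count-step x n with x n
... | true  = ℕ.n≤1+n _
... | false = ℕ.≤-refl

count-mono : ∀ x {m n} → m ℕ.≤ n → count x m ℕ.≤ count x n
count-mono x = stepwise⇒monotone ℕ._≤_ ℕ.≤-refl ℕ.≤-trans (count x) (count-step x)

count-local : ∀ {x y n} → Ball x n y → ∀ k → k ℕ.≤ n → count y k ≡ count x k
count-local agree zero    _   = refl
count-local agree (suc k) k<n =
  cong₂ (λ b c → if b then suc c else c) (agree k k<n) (count-local agree k (ℕ.<⇒≤ k<n))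

-- The point x codes the series whose terms are 0 where x is false, and are
-- the successive increments of C where x is true.
codedTerm : (ℕ → ℚ) → Cantor → ℕ → ℚ
codedTerm C x = increment (C ∘ count x)

codedSum : Subset → (ℕ → ℚ) → Cantor → ℕ → ℚ
codedSum A C x = sumOver A (codedTerm C x)

-- Lets a bound on one coded sum hold on a whole ball.
codedSum-local : ∀ A C {x y n} → Ball x n y → ∀ k → k ℕ.≤ n → codedSum A C y k ≡ codedSum A C x k
codedSum-local A C agree zero    _   = refl
codedSum-local A C agree (suc k) k<n = cong₂ (λ s t → if A k then s ℚ.+ t else s)
  (codedSum-local A C agree k (ℕ.<⇒≤ k<n))
  (cong₂ (λ i j → C i ℚ.- C j)
    (count-local agree (suc k) k<n) (count-local agree k (ℕ.<⇒≤ k<n)))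

-- Places where `x` is false contribute 0, and the others run through the increments of `C` without
-- skipping any.
codedVariation : ∀ C x n → variation (C ∘ count x) n ≡ variation C (count x n)
codedVariation C x zero = refl
codedVariation C x (suc n) with x n
... | true  = cong (ℚ._+ ℚ.∣ increment C (count x n) ∣) (codedVariation C x n)
... | false = trans
  (cong₂ (λ v d → v ℚ.+ ℚ.∣ d ∣) (codedVariation C x n) (ℚ.+-inverseʳ (C (count x n))))
  (ℚ.+-identityʳ _)

Frequently : Subset → Bool → Set
Frequently A b = ∀ m → ∃[ n ] m ℕ.≤ n × A n ≡ b

Eventually : Subset → Bool → Set
Eventually A b = ∃[ m ] ∀ n → m ℕ.≤ n → A n ≡ b

¬eventually⇒frequently : ExcludedMiddle 0ℓ → ∀ A b → ¬ Eventually A (not b) → Frequently A b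
¬eventually⇒frequently em A b ¬ev m with em {∃[ n ] m ℕ.≤ n × A n ≡ b}
... | yes found = found
... | no  none  = contradiction
  (m , λ n m≤n → Bool.¬-not λ An≡b → none (n , m≤n , An≡b)) ¬ev

count-unbounded : ∀ x → Frequently x true → ∀ k → ∃[ n ] k ℕ.≤ count x n
count-unbounded x freq zero = 0 , ℕ.z≤n
count-unbounded x freq (suc k) with count-unbounded x freq k
... | m , k≤ with freq m
... | n , m≤n , xn = suc n , subst (λ b → suc k ℕ.≤ (if b then suc (count x n) else count x n))
  (sym xn) (ℕ.s≤s (ℕ.≤-trans k≤ (count-mono x m≤n)))

-- From `m` on, the sum telescopes if `A` contains every place and is stationary if it contains
-- none. The first case adds a difference of two values of `C`, at most β; the 0 in the maximum
-- serves the second.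
codedSum-bounded : ∀ A C → Bounded C → ∀ b → Eventually A b →
  ∀ x → ∃[ B ] ∃[ m ] ∀ n → m ℕ.≤ n → codedSum A C x n ℚ.≤ B
codedSum-bounded A C (β , C≤β) b (m , const) x = s m ℚ.+ (0ℚ ℚ.⊔ β) , m , λ n m≤n →
  ℚ.≤-trans (ℚ.≤-reflexive (split (ℕ.≤⇒≤′ m≤n))) (ℚ.+-monoʳ-≤ (s m) (bound b n))
  where
  open +-*-Solver
  s = codedSum A C x
  K : ℕ → ℚ
  K = C ∘ count x
  after : Bool → ℕ → ℚ
  after b n = if b then K n ℚ.- K m else 0ℚ
  bound : ∀ b n → after b n ℚ.≤ 0ℚ ℚ.⊔ β
  bound true  n = ℚ.≤-trans (C≤β (count x n) (count x m)) (ℚ.p≤q⊔p 0ℚ β)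
  bound false n = ℚ.p≤p⊔q 0ℚ β
  base : ∀ b → s m ≡ s m ℚ.+ after b m
  base true  = solve 2 (λ s k → s := s :+ (k :- k)) refl (s m) (K m)
  base false = sym (ℚ.+-identityʳ (s m))
  step : ∀ b n → A n ≡ b → s n ≡ s m ℚ.+ after b n → s (suc n) ≡ s m ℚ.+ after b (suc n)
  step true n An eq rewrite An | eq =
    solve 4 (λ s k l i → (s :+ (l :- k)) :+ (i :- l) := s :+ (i :- k)) refl
      (s m) (K m) (K n) (K (suc n))
  step false n An eq rewrite An = eq
  split : ∀ {n} → m ℕ.≤′ n → s n ≡ s m ℚ.+ after b n
  split ℕ.≤′-refl       = base b
  split (ℕ.≤′-step m≤n) = step b _ (const _ (ℕ.≤′⇒≤ m≤n)) (split m≤n)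

-- Greedy extension of an initial segment.

module _ (rule : ℕ → ℕ → Bool) where

  private
    -- The count of the point under construction. It is defined before the point because the rule
    -- for each bit consults the count reached so far.
    progress : ℕ → ℕ
    progress zero    = 0
    progress (suc p) = if rule p (progress p) then suc (progress p) else progress p

  followRule : Cantor
  followRule p = rule p (progress p)

  private
    count≡progress : ∀ p → count followRule p ≡ progress p
    count≡progress zero    = refl
    count≡progress (suc p) =
      cong (λ c → if followRule p then suc c else c) (count≡progress p)

  followRule-follows : ∀ p → followRule p ≡ rule p (count followRule p)
  followRule-follows p = cong (rule p) (sym (count≡progress p))

-- Negative increments of C are placed on A and the others off A.
module Greedy (A : Subset) (C : ℕ → ℚ) (x : Cantor) (m : ℕ) where

  descends : ℕ → Bool
  descends k = does (increment C k ℚ.<? 0ℚ)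

  private
    rule : ℕ → ℕ → Bool
    -- Past `m` the bit is true when `p` is in `A` and the next increment is negative, or `p` is off
    -- `A` and it is not. A false bit postpones the increment to a later place.
    rule p k = if does (p ℕ.<? m) then x p else does (A p Bool.≟ descends k)

  greedy : Cantor
  greedy = followRule rule

  private
    s : ℕ → ℚ
    s = codedSum A C greedy
    D : ℕ → ℚ
    D = descent C ∘ count greedy

  greedy-extends : Ball x m greedy
  greedy-extends k k<m = trans (followRule-follows rule k)
    (cong (λ b → if b then x k else does (A k Bool.≟ descends (count greedy k)))
      (dec-true (k ℕ.<? m) k<m))

  greedy-choice : ∀ p → m ℕ.≤ p → greedy p ≡ does (A p Bool.≟ descends (count greedy p))
  greedy-choice p m≤p = trans (followRule-follows rule p)
    (cong (λ b → if b then x p else does (A p Bool.≟ descends (count greedy p)))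
      (dec-false (p ℕ.<? m) (ℕ.≤⇒≯ m≤p)))

  private
    -- An increment placed on `A` is negative and enters both the sum and the descent; one placed
    -- off `A` is nonnegative and changes neither. A general `y` lets the case split on `y p` reduce
    -- `count y (suc p)`.
    step : ∀ y p (c<0? : Dec (increment C (count y p) ℚ.< 0ℚ)) →
      y p ≡ does (A p Bool.≟ does c<0?) →
      codedSum A C y (suc p) ≡
      codedSum A C y p ℚ.+ (descent C (count y (suc p)) ℚ.- descent C (count y p))
    step y p c<0? choice with A p | y p | c<0?
    ... | true  | false | _ = cong (codedSum A C y p ℚ.+_)
      (trans (ℚ.+-inverseʳ (C (count y p))) (sym (ℚ.+-inverseʳ (descent C (count y p)))))
    ... | false | false | _ = solve 2 (λ s d → s := s :+ (d :- d)) refl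
      (codedSum A C y p) (descent C (count y p))
      where open +-*-Solver
    ... | true  | true  | yes c<0 = cong (codedSum A C y p ℚ.+_) (trans
      (sym (ℚ.p≤q⇒p⊓q≡p (ℚ.<⇒≤ c<0)))
      (solve 2 (λ d c → c := (d :+ c) :- d) refl (descent C (count y p)) _))
      where open +-*-Solver
    ... | false | true  | no  c≮0 = trans
      (solve 2 (λ s d → s := s :+ ((d :+ con 0ℚ) :- d)) refl
        (codedSum A C y p) (descent C (count y p)))
      (cong (λ c → codedSum A C y p ℚ.+ ((descent C (count y p) ℚ.+ c) ℚ.- descent C (count y p)))
        (sym (ℚ.p≥q⇒p⊓q≡q (ℚ.≮⇒≥ c≮0))))
      where open +-*-Solver
    step y p _ () | true  | true  | no  _
    step y p _ () | false | true  | yes _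

  greedy-sum : ∀ {p} → m ℕ.≤ p → s p ≡ s m ℚ.+ (D p ℚ.- D m)
  greedy-sum m≤p = go (ℕ.≤⇒≤′ m≤p)
    where
    open +-*-Solver
    go : ∀ {p} → m ℕ.≤′ p → s p ≡ s m ℚ.+ (D p ℚ.- D m)
    go ℕ.≤′-refl = solve 2 (λ s d → s := s :+ (d :- d)) refl (s m) (D m)
    go (ℕ.≤′-step {p} m≤p) = trans (step greedy p (increment C (count greedy p) ℚ.<? 0ℚ)
      (greedy-choice p (ℕ.≤′⇒≤ m≤p))) (trans
      (cong (ℚ._+ (D (suc p) ℚ.- D p)) (go m≤p))
      (solve 4 (λ s a b c → (s :+ (b :- a)) :+ (c :- b) := s :+ (c :- a)) refl
        (s m) (D m) (D p) (D (suc p))))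

  -- No increment is postponed forever, since `A` takes both values infinitely often. At the next
  -- place `q` of the kind wanted by increment `k`, either the count has already passed `k`, or it
  -- is still `k` and the bit at `q` is true.
  greedy-count : (∀ b → Frequently A b) → ∀ k → ∃[ p ] m ℕ.≤ p × k ℕ.≤ count greedy p
  greedy-count freq zero = m , ℕ.≤-refl , ℕ.z≤n
  greedy-count freq (suc k) with greedy-count freq k
  ... | p , m≤p , k≤ with freq (descends k) p
  ... | q , p≤q , Aq with ℕ.m≤n⇒m<n∨m≡n (ℕ.≤-trans k≤ (count-mono greedy p≤q))
  ...   | inj₁ k<count = q , ℕ.≤-trans m≤p p≤q , k<count
  ...   | inj₂ refl = suc q , ℕ.≤-trans m≤p (ℕ.m≤n⇒m≤1+n p≤q) ,
    ℕ.≤-reflexive (sym (cong (λ b → if b then suc (count greedy q) else count greedy q)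
      (trans (greedy-choice q (ℕ.≤-trans m≤p p≤q)) (dec-true (A q Bool.≟ _) Aq))))

  greedy-nonPositive : (∀ b → Frequently A b) → UnboundedDescent C →
    ∃[ p ] m ℕ.≤ p × s p ℚ.≤ 0ℚ
  -- By `greedy-sum`, `s p` is at most 0 once `D p` is at most `D m` minus `s m`.
  greedy-nonPositive freq unbounded with unbounded (D m ℚ.- s m)
  ... | k , low with greedy-count freq k
  ... | p , m≤p , k≤ = p , m≤p , (begin
    s p                                  ≡⟨ greedy-sum m≤p ⟩
    s m ℚ.+ (D p ℚ.- D m)
      ≤⟨ ℚ.+-monoʳ-≤ (s m) (ℚ.+-monoˡ-≤ (ℚ.- D m)
           (ℚ.≤-trans (descent-antitone C k≤) low)) ⟩
    s m ℚ.+ ((D m ℚ.- s m) ℚ.- D m)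
      ≡⟨ solve 2 (λ s d → s :+ ((d :- s) :- d) := con 0ℚ) refl (s m) (D m) ⟩
    0ℚ                                   ∎)
    where
    open ℚ.≤-Reasoning
    open +-*-Solver

-- Nowhere dense sets in the Cantor space.

Avoidable : Pred Cantor 0ℓ → Set
Avoidable P = ∀ x n → ∃[ y ] Ball x n y × (∃[ m ] ∀ z → Ball y m z → ¬ P z)

Ball-trans : ∀ {x y z m n} → m ℕ.≤ n → Ball x m y → Ball y n z → Ball x m z
Ball-trans m≤n xy yz k k<m = trans (yz k (ℕ.<-≤-trans k<m m≤n)) (xy k k<m)

Ball-shrink : ∀ {x y m n} → m ℕ.≤ n → Ball x n y → Ball x m y
Ball-shrink m≤n = Ball-trans m≤n (λ _ _ → refl)

-- `Avoidable` says that the complement has dense interior, a form free of closures that is easy to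
-- check and to combine.
avoidable⇒nowhereDense : ∀ {P} → Avoidable P → NowhereDense P
avoidable⇒nowhereDense avoid x (n , dense) with avoid x n
... | y , xy , m , none with dense y xy m
... | z , yz , Pz = none z yz Pz

avoidable-∪ : ∀ {P Q : Pred Cantor 0ℓ} → Avoidable P → Avoidable Q → Avoidable (λ x → P x ⊎ Q x)
avoidable-∪ avoidP avoidQ x n with avoidP x n
-- Depth `n ⊔ m` keeps the next point both in the given ball around `x` and in the ball around `y`
-- that misses `P`.
... | y , xy , m , ¬P with avoidQ y (n ℕ.⊔ m)
... | z , yz , l , ¬Q = z , Ball-trans (ℕ.m≤m⊔n n m) xy yz , m ℕ.⊔ l , λ w zw →
  [ ¬P w (Ball-trans (ℕ.m≤m⊔n m l) (Ball-shrink (ℕ.m≤n⊔m n m) yz) zw)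
  , ¬Q w (Ball-shrink (ℕ.m≤n⊔m m l) zw)
  ]′

FalseFrom : ℕ → Pred Cantor 0ℓ
FalseFrom m x = ∀ n → m ℕ.≤ n → x n ≡ false

-- The only trace of divergence to +∞ that the category argument needs; fixing `m` makes it a
-- countable union of conditions.
PositiveFrom : Subset → (ℕ → ℚ) → ℕ → Pred Cantor 0ℓ
PositiveFrom A C m x = ∀ n → m ℕ.≤ n → 0ℚ ℚ.< codedSum A C x n

-- Continuing the segment with `true` puts a `true` at place `n ⊔ m`, past both the segment and the
-- stage.
falseFrom-avoidable : ∀ m → Avoidable (FalseFrom m)
falseFrom-avoidable m x n = y ,
  (λ k k<n → cong (λ b → if b then x k else true) (dec-true (k ℕ.<? n) k<n)) ,
  suc (n ℕ.⊔ m) , λ z yz Fz → contradiction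
    (trans (sym (trans (yz (n ℕ.⊔ m) ℕ.≤-refl)
      (cong (λ b → if b then x (n ℕ.⊔ m) else true)
        (dec-false (n ℕ.⊔ m ℕ.<? n) (ℕ.≤⇒≯ (ℕ.m≤m⊔n n m))))))
      (Fz (n ℕ.⊔ m) (ℕ.m≤n⊔m n m)))
    λ ()
  where
  y : Cantor
  y k = if does (k ℕ.<? n) then x k else true

-- Greedy extension of the first `n ⊔ m` bits makes the sum nonpositive at some `p` beyond `m`, and
-- so it is for every point agreeing up to `p`.
positiveFrom-avoidable : ∀ A C → (∀ b → Frequently A b) → UnboundedDescent C →
  ∀ m → Avoidable (PositiveFrom A C m)
positiveFrom-avoidable A C freq unbounded m x n =
  let p , ≤p , s≤0 = greedy-nonPositive freq unbounded in
  greedy , Ball-shrink (ℕ.m≤m⊔n n m) greedy-extends , p , λ z yz pos →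
    p≤q⇒p≯q (subst (ℚ._≤ 0ℚ) (sym (codedSum-local A C yz p ℕ.≤-refl)) s≤0)
      (pos p (ℕ.m⊔n≤o⇒n≤o n m ≤p))
  where open Greedy A C x (n ℕ.⊔ m)

-- Conditional convergence of the coded series.

p≤∣p∣ : ∀ p → p ℚ.≤ ℚ.∣ p ∣
p≤∣p∣ p with ℚ.≤-total 0ℚ p
... | inj₁ 0≤p = ℚ.≤-reflexive (sym (ℚ.0≤p⇒∣p∣≡p 0≤p))
... | inj₂ p≤0 = ℚ.≤-trans p≤0 (ℚ.0≤∣p∣ p)

<-+-pos : ∀ {p δ q} → 0ℚ ℚ.< δ → p ℚ.+ δ ℚ.≤ q → p ℚ.< q
<-+-pos {p} {δ} 0<δ p+δ≤q = ℚ.<-≤-trans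
  (subst (ℚ._< p ℚ.+ δ) (ℚ.+-identityʳ p) (ℚ.+-monoʳ-< p 0<δ)) p+δ≤q

constant : ℚ → ℝ
constant q = mkℝ (λ _ → q) λ ε 0<ε → 0 , λ _ _ _ _ →
  subst (ℚ._< ε) (cong ℚ.∣_∣ (sym (ℚ.+-inverseʳ q))) 0<ε

codedSeries : (ℕ → ℚ) → Cantor → Series
codedSeries C x n = constant (codedTerm C x n)

approx-partialSum : ∀ A a f → (∀ n j → approx (a n) j ≡ f n) →
  ∀ n j → approx (partialSum A a n) j ≡ sumOver A f n
approx-partialSum A a f a≡f zero    j = refl
approx-partialSum A a f a≡f (suc n) j with A n
... | true  = cong₂ ℚ._+_ (approx-partialSum A a f a≡f n j) (a≡f n j)
... | false = approx-partialSum A a f a≡f n j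

approx-codedSum : ∀ A C x n j → approx (partialSum A (codedSeries C x) n) j ≡ codedSum A C x n
approx-codedSum A C x = approx-partialSum A (codedSeries C x) (codedTerm C x) (λ _ _ → refl)

unbounded⇒¬convergent : ∀ a f → (∀ n j → approx (a n) j ≡ f n) →
  (∀ b m → ∃[ n ] m ℕ.≤ n × b ℚ.≤ total f n) → ¬ Convergent a
unbounded⇒¬convergent a f a≡f unbounded (l , conv)
  with conv (constant 1ℚ) (1ℚ , 0<1 , 0 , λ _ _ → ℚ.≤-refl) | cauchy l 1ℚ 0<1
  where
  0<1 : 0ℚ ℚ.< 1ℚ
  0<1 = from-yes (0ℚ ℚ.<? 1ℚ)
-- One unit covers the distance from the partial sum to the limit, the other that from the limit to
-- its fixed approximation at `J`.
... | N , near | J , close with unbounded (approx l J ℚ.+ (1ℚ ℚ.+ 1ℚ)) N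
... | n , N≤n , large with near n N≤n
... | δ , 0<δ , M , gap = p≤q⇒p≯q large (begin-strict
  s
    ≡⟨ solve 3 (λ s i j → s := (s :- i) :+ ((i :- j) :+ j)) refl s l₁ l₀ ⟩
  (s ℚ.- l₁) ℚ.+ ((l₁ ℚ.- l₀) ℚ.+ l₀)
    <⟨ ℚ.+-mono-< (ℚ.≤-<-trans (p≤∣p∣ (s ℚ.- l₁)) s-near)
         (ℚ.+-monoˡ-< l₀ (ℚ.≤-<-trans (p≤∣p∣ (l₁ ℚ.- l₀)) l-near)) ⟩
  1ℚ ℚ.+ (1ℚ ℚ.+ l₀)
    ≡⟨ solve 2 (λ e l → e :+ (e :+ l) := l :+ (e :+ e)) refl 1ℚ l₀ ⟩
  l₀ ℚ.+ (1ℚ ℚ.+ 1ℚ) ∎)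
  where
  open ℚ.≤-Reasoning
  open +-*-Solver
  j = J ℕ.⊔ M
  s = total f n
  l₀ = approx l J
  l₁ = approx l j
  s-near : ℚ.∣ s ℚ.- l₁ ∣ ℚ.< 1ℚ
  s-near = <-+-pos 0<δ
    (subst (λ t → ℚ.∣ t ℚ.- l₁ ∣ ℚ.+ δ ℚ.≤ 1ℚ)
      (approx-partialSum (λ _ → true) a f a≡f n j) (gap j (ℕ.m≤n⊔m J M)))
  l-near : ℚ.∣ l₁ ℚ.- l₀ ∣ ℚ.< 1ℚ
  l-near = close j J (ℕ.m≤m⊔n J M) ℕ.≤-refl

Null : (ℕ → ℚ) → Set
Null C = ∀ ε → 0ℚ ℚ.< ε → ∃[ m ] ∀ n → m ℕ.≤ n → ℚ.∣ C n ∣ ℚ.≤ ε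

-- The partial sums telescope to `C (count x n)` minus `C 0`, and the count grows without bound.
codedSeries-convergent : ∀ C x → Null C → Frequently x true → Convergent (codedSeries C x)
codedSeries-convergent C x null freq = constant (ℚ.- C 0) , conv
  where
  open ℚ.≤-Reasoning
  open +-*-Solver
  conv : ConvergesTo (partialSum (λ _ → true) (codedSeries C x)) (constant (ℚ.- C 0))
  -- Half of δ bounds the error; the other half is the gap that `<` on reals demands.
  conv ε (δ , 0<δ , J , gap) with null (½ ℚ.* δ) (ℚ.*-monoʳ-<-pos ½ 0<δ)
  ... | K , small with count-unbounded x freq K
  ... | N , K≤ = N , λ n N≤n → ½ ℚ.* δ , ℚ.*-monoʳ-<-pos ½ 0<δ , J , λ j J≤j → begin
    ℚ.∣ approx (partialSum (λ _ → true) (codedSeries C x) n) j ℚ.- (ℚ.- C 0) ∣ ℚ.+ ½ ℚ.* δ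
      ≡⟨ cong (λ s → ℚ.∣ s ℚ.- (ℚ.- C 0) ∣ ℚ.+ ½ ℚ.* δ)
           (trans (approx-codedSum (λ _ → true) C x n j) (total-increment (C ∘ count x) n)) ⟩
    ℚ.∣ (C (count x n) ℚ.- C 0) ℚ.- (ℚ.- C 0) ∣ ℚ.+ ½ ℚ.* δ
      ≡⟨ cong (λ s → ℚ.∣ s ∣ ℚ.+ ½ ℚ.* δ)
           (solve 2 (λ c z → (c :- z) :- (:- z) := c) refl (C (count x n)) (C 0)) ⟩
    ℚ.∣ C (count x n) ∣ ℚ.+ ½ ℚ.* δ
      ≤⟨ ℚ.+-monoˡ-≤ (½ ℚ.* δ) (small (count x n) (ℕ.≤-trans K≤ (count-mono x N≤n))) ⟩
    ½ ℚ.* δ ℚ.+ ½ ℚ.* δ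
      ≡⟨ solve 1 (λ d → con ½ :* d :+ con ½ :* d := con 0ℚ :+ d) refl δ ⟩
    0ℚ ℚ.+ δ
      ≤⟨ gap j J≤j ⟩
    approx ε j ∎

codedSeries-¬absolute : ∀ C x → UnboundedVariation C → Frequently x true →
  ¬ Convergent (λ n → ∣ codedSeries C x n ∣)
codedSeries-¬absolute C x unbounded freq =
  unbounded⇒¬convergent _ (λ n → ℚ.∣ codedTerm C x n ∣) (λ _ _ → refl) large
  where
  large : ∀ b m → ∃[ n ] m ℕ.≤ n × b ℚ.≤ variation (C ∘ count x) n
  large b m with unbounded b
  ... | k , b≤ with count-unbounded x freq k
  ... | n , k≤ = m ℕ.⊔ n , ℕ.m≤m⊔n m n ,
    subst (b ℚ.≤_) (sym (codedVariation C x (m ℕ.⊔ n)))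
      (ℚ.≤-trans b≤ (variation-mono C (ℕ.≤-trans k≤ (count-mono x (ℕ.m≤n⊔m m n)))))

-- Change of sign and divergence to infinity.

opposite : (ℕ → ℚ) → ℕ → ℚ
opposite C k = ℚ.- C k

increment-opposite : ∀ C k → increment (opposite C) k ≡ ℚ.- increment C k
increment-opposite C k = sym (ℚ.neg-distrib-+ (C (suc k)) (ℚ.- C k))

variation-opposite : ∀ C n → variation (opposite C) n ≡ variation C n
variation-opposite C zero    = refl
variation-opposite C (suc n) = cong₂ ℚ._+_ (variation-opposite C n)
  (trans (cong ℚ.∣_∣ (increment-opposite C n)) (ℚ.∣-p∣≡∣p∣ (increment C n)))

unboundedVariation-opposite : ∀ C → UnboundedVariation C → UnboundedVariation (opposite C)
unboundedVariation-opposite C unbounded b with unbounded b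
... | k , b≤ = k , subst (b ℚ.≤_) (sym (variation-opposite C k)) b≤

bounded-opposite : ∀ C → Bounded C → Bounded (opposite C)
bounded-opposite C (β , C≤β) = β , λ k l →
  subst (ℚ._≤ β) (solve 2 (λ c d → d :- c := (:- c) :- (:- d)) refl (C k) (C l)) (C≤β l k)
  where open +-*-Solver

-- Reduces divergence to -∞ to divergence to +∞.
codedSum-opposite : ∀ A C x n → codedSum A (opposite C) x n ≡ ℚ.- codedSum A C x n
codedSum-opposite A C x zero = refl
codedSum-opposite A C x (suc n) with A n
... | true  = trans
  (cong₂ ℚ._+_ (codedSum-opposite A C x n) (increment-opposite (C ∘ count x) n))
  (sym (ℚ.neg-distrib-+ (codedSum A C x n) (codedTerm C x n)))
... | false = codedSum-opposite A C x n

TendsTo+∞ : (ℕ → ℚ) → Set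
TendsTo+∞ s = ∀ b → ∃[ m ] ∀ n → m ℕ.≤ n → b ℚ.< s n

bounded⇒¬tendsTo+∞ : ∀ {s} B → (∃[ m ] ∀ n → m ℕ.≤ n → s n ℚ.≤ B) → ¬ TendsTo+∞ s
bounded⇒¬tendsTo+∞ B (m , s≤B) tends with tends B
... | N , B<s = p≤q⇒p≯q (s≤B (m ℕ.⊔ N) (ℕ.m≤m⊔n m N)) (B<s (m ℕ.⊔ N) (ℕ.m≤n⊔m m N))

divergesTo+∞⇒tendsTo+∞ : ∀ A C x →
  DivergesTo+∞ (partialSum A (codedSeries C x)) → TendsTo+∞ (codedSum A C x)
divergesTo+∞⇒tendsTo+∞ A C x div b with div (constant b)
... | N , b<s = N , λ n N≤n → let δ , 0<δ , M , gap = b<s n N≤n in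
  <-+-pos 0<δ (subst (b ℚ.+ δ ℚ.≤_) (approx-codedSum A C x n M) (gap M ℕ.≤-refl))

divergesTo-∞⇒tendsTo+∞ : ∀ A C x →
  DivergesTo-∞ (partialSum A (codedSeries C x)) → TendsTo+∞ (codedSum A (opposite C) x)
divergesTo-∞⇒tendsTo+∞ A C x div b with div (constant (ℚ.- b))
... | N , s<-b = N , λ n N≤n → let δ , 0<δ , M , gap = s<-b n N≤n in
  subst (ℚ._< codedSum A (opposite C) x n) (solve 1 (λ b → :- (:- b) := b) refl b)
    (subst (ℚ.- (ℚ.- b) ℚ.<_) (sym (codedSum-opposite A C x n))
      (ℚ.neg-antimono-< (<-+-pos 0<δ
        (subst (λ s → s ℚ.+ δ ℚ.≤ ℚ.- b) (approx-codedSum A C x n M) (gap M ℕ.≤-refl)))))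
  where open +-*-Solver

-- A null sequence of unbounded variation.

odd : ℕ → Bool
odd zero    = false
odd (suc n) = not (odd n)

-- The sequence 0, 1/2, 0, 1/4, 0, 1/6, and so on.
zigzag : ℕ → ℚ
zigzag k = if odd k then unitFraction k else 0ℚ

zigzag-nonNegative : ∀ k → 0ℚ ℚ.≤ zigzag k
zigzag-nonNegative k with odd k
... | true  = unitFraction-nonNegative k
... | false = ℚ.≤-refl

zigzag-≤ : ∀ k → zigzag k ℚ.≤ unitFraction k
zigzag-≤ k with odd k
... | true  = ℚ.≤-refl
... | false = unitFraction-nonNegative k

zigzag-bounded : Bounded zigzag
zigzag-bounded = 1ℚ , λ k l → ℚ.+-mono-≤
  (ℚ.≤-trans (zigzag-≤ k) (unitFraction-antitone {0} {k} ℕ.z≤n))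
  (ℚ.neg-antimono-≤ (zigzag-nonNegative l))

zigzag-null : Null zigzag
zigzag-null ε 0<ε with unitFraction-null ε 0<ε
... | m , small = m , λ n m≤n → begin
  ℚ.∣ zigzag n ∣  ≡⟨ ℚ.0≤p⇒∣p∣≡p (zigzag-nonNegative n) ⟩
  zigzag n        ≤⟨ zigzag-≤ n ⟩
  unitFraction n  ≤⟨ unitFraction-antitone {m} {n} m≤n ⟩
  unitFraction m  ≤⟨ small ⟩
  ε               ∎
  where open ℚ.≤-Reasoning

-- Of two neighbouring values one is 0 and the other is 1/(k+1) or 1/(k+2).
zigzag-increment : ∀ k → unitFraction (suc k) ℚ.≤ ℚ.∣ increment zigzag k ∣
zigzag-increment k with odd k
... | true  = begin
  unitFraction (suc k)           ≤⟨ unitFraction-antitone {k} {suc k} (ℕ.n≤1+n k) ⟩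
  unitFraction k                 ≡⟨ ℚ.0≤p⇒∣p∣≡p (unitFraction-nonNegative k) ⟨
  ℚ.∣ unitFraction k ∣           ≡⟨ ℚ.∣-p∣≡∣p∣ (unitFraction k) ⟨
  ℚ.∣ ℚ.- unitFraction k ∣       ≡⟨ cong ℚ.∣_∣ (ℚ.+-identityˡ (ℚ.- unitFraction k)) ⟨
  ℚ.∣ 0ℚ ℚ.- unitFraction k ∣    ∎
  where open ℚ.≤-Reasoning
... | false = begin
  unitFraction (suc k)             ≡⟨ ℚ.+-identityʳ (unitFraction (suc k)) ⟨
  unitFraction (suc k) ℚ.- 0ℚ      ≤⟨ p≤∣p∣ _ ⟩
  ℚ.∣ unitFraction (suc k) ℚ.- 0ℚ ∣ ∎
  where open ℚ.≤-Reasoning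

zigzag-unboundedVariation : UnboundedVariation zigzag
zigzag-unboundedVariation b with harmonic-unbounded b
... | k , b≤ = k , ℚ.≤-trans b≤ (total-mono zigzag-increment k)

zigzag-conditional : ∀ x → Frequently x true → ConditionallyConvergent (codedSeries zigzag x)
zigzag-conditional x freq =
  codedSeries-convergent zigzag x zigzag-null freq ,
  codedSeries-¬absolute zigzag x zigzag-unboundedVariation freq

-- The meager set attached to a subset of ℕ.

EventuallyConstant : Subset → Set
EventuallyConstant A = ∃[ b ] Eventually A b

-- `FalseFrom` absorbs the points whose series has finitely many nonzero terms. The negated clause
-- is there because for cofinite `A` positivity can hold on a whole ball, for instance when `A`
-- omits just one place and a negative increment sits there.
DivergenceStage : Subset → ℕ → Pred Cantor 0ℓ
DivergenceStage A m x = FalseFrom m x ⊎ ¬ EventuallyConstant A ×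
  (PositiveFrom A zigzag m x ⊎ PositiveFrom A (opposite zigzag) m x)

divergenceStage-avoidable : ExcludedMiddle 0ℓ → ∀ A m → Avoidable (DivergenceStage A m)
divergenceStage-avoidable em A m = avoidable-∪ (falseFrom-avoidable m) λ x n →
  split x n (em {EventuallyConstant A})
  where
  Positive : Pred Cantor 0ℓ
  Positive x = PositiveFrom A zigzag m x ⊎ PositiveFrom A (opposite zigzag) m x
  positive-avoidable : (∀ b → Frequently A b) → Avoidable Positive
  positive-avoidable freq = avoidable-∪
    (positiveFrom-avoidable A zigzag freq
      (descent-unbounded zigzag zigzag-bounded zigzag-unboundedVariation) m)
    (positiveFrom-avoidable A (opposite zigzag) freq
      (descent-unbounded (opposite zigzag) (bounded-opposite zigzag zigzag-bounded)
        (unboundedVariation-opposite zigzag zigzag-unboundedVariation)) m)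
  split : ∀ x n → Dec (EventuallyConstant A) →
    ∃[ y ] Ball x n y × (∃[ k ] ∀ z → Ball y k z → ¬ (¬ EventuallyConstant A × Positive z))
  split x n (yes const) = x , (λ _ _ → refl) , 0 , λ _ _ (¬const , _) → ¬const const
  split x n (no ¬const) =
    let y , xy , k , none = positive-avoidable
          (λ b → ¬eventually⇒frequently em A b λ ev → ¬const (not b , ev)) x n
    in y , xy , k , λ z yz (_ , pos) → none z yz pos

divergenceSet : Subset → Pred Cantor 0ℓ
divergenceSet A = ⋃ ℕ (DivergenceStage A)

divergenceSet-meager : ExcludedMiddle 0ℓ → ∀ A → Meager (divergenceSet A)
divergenceSet-meager em A = DivergenceStage A ,
  (λ m → avoidable⇒nowhereDense (divergenceStage-avoidable em A m)) , ≐-refl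

tendsTo+∞⇒¬eventuallyConstant : ∀ A C x → Bounded C → TendsTo+∞ (codedSum A C x) →
  ¬ EventuallyConstant A
tendsTo+∞⇒¬eventuallyConstant A C x bounded tends (b , ev) =
  let B , eventually≤B = codedSum-bounded A C bounded b ev x in
  bounded⇒¬tendsTo+∞ B eventually≤B tends

-- The stage is one from which the sum exceeds 0; divergence also rules out that `A` is eventually
-- constant.
diverges⇒divergenceSet : ∀ A x →
  SubseriesDivergesTo±∞ A (codedSeries zigzag x) → divergenceSet A x
diverges⇒divergenceSet A x (inj₁ div) =
  let tends = divergesTo+∞⇒tendsTo+∞ A zigzag x div
      m , 0<s = tends 0ℚ
  in m , inj₂ (tendsTo+∞⇒¬eventuallyConstant A zigzag x zigzag-bounded tends , inj₁ 0<s)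
diverges⇒divergenceSet A x (inj₂ div) =
  let tends = divergesTo-∞⇒tendsTo+∞ A zigzag x div
      m , 0<s = tends 0ℚ
  in m , inj₂ (tendsTo+∞⇒¬eventuallyConstant A (opposite zigzag) x
       (bounded-opposite zigzag zigzag-bounded) tends , inj₂ 0<s)

divergenceSets-cover : ExcludedMiddle 0ℓ → ∀ {K} ((𝒜 , _) : SubseriesFamily K) →
  Universal (⋃ K (divergenceSet ∘ 𝒜))
divergenceSets-cover em {K} (𝒜 , _ , covers) x = locate (em {Eventually x false})
  where
  locate : Dec (Eventually x false) → ∃[ k ] divergenceSet (𝒜 k) x
  locate (yes (m , ev)) =
    -- An eventually false point lies in every divergence set, so any index will do; the constantly
    -- true point supplies one.
    let k , _ = covers _ (zigzag-conditional (λ _ → true) λ n → n , ℕ.≤-refl , refl)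
    in k , m , inj₁ ev
  locate (no ¬ev) =
    let k , div = covers _ (zigzag-conditional x (¬eventually⇒frequently em x true ¬ev))
    in k , diverges⇒divergenceSet (𝒜 k) x div

-- Covers without repetition and the comparison of cardinals.

removeRepetitions : AxiomOfChoice → ∀ {K : Set} (ℳ : K → Pred Cantor 0ℓ) →
  (∀ k → Meager (ℳ k)) → Universal (⋃ K ℳ) → ∃[ L ] MeagerCover L × (L ↣ K)
removeRepetitions ac {K} ℳ meager covers =
  L , (ℳ ∘ proj₁ , injective , meager ∘ proj₁ , covers′) , mk↣ proj₁-injective
  where
  -- Repetitions do occur among divergence sets: all eventually constant subsets share one. Indices
  -- are therefore grouped by equality of their sets.
  choice = ac record { isEquivalence = On.isEquivalence ℳ ≐-isEquivalence }
  rep : K → K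
  rep = proj₁ choice
  rep≈ : ∀ k → ℳ (rep k) ≐ ℳ k
  rep≈ = proj₁ (proj₂ choice)
  rep-cong : ∀ {k l} → ℳ k ≐ ℳ l → rep k ≡ rep l
  rep-cong = proj₂ (proj₂ choice)
  -- The fixed points of `rep` form a transversal of the classes.
  L : Set
  L = Σ[ k ∈ K ] rep k ≡ k
  proj₁-injective : Injective {A = L} _≡_ _≡_ proj₁
  proj₁-injective {_ , p} {_ , q} refl = cong (_ ,_) (uip p q)
  injective : Injective {A = L} _≡_ _≐_ (ℳ ∘ proj₁)
  injective {k , k≡} {l , l≡} eq = proj₁-injective (trans (sym k≡) (trans (rep-cong eq) l≡))
  covers′ : Universal (⋃ L (ℳ ∘ proj₁))
  covers′ x = let k , x∈ = covers x in
    (rep k , rep-cong (rep≈ k)) , proj₂ (rep≈ k) x∈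

meagerCover-from-subseriesFamily : ExcludedMiddle 0ℓ → AxiomOfChoice →
  ∀ K → SubseriesFamily K → ∃[ L ] MeagerCover L × (L ↣ K)
meagerCover-from-subseriesFamily em ac K family@(𝒜 , _) = removeRepetitions ac
  (divergenceSet ∘ 𝒜) (divergenceSet-meager em ∘ 𝒜) (divergenceSets-cover em family)

theorem15 : ExcludedMiddle 0ℓ → AxiomOfChoice →
    (∀ K L → Is-ßᵢ K → Is-cov[𝓜] L → L ↣ K) ×
    (∀ K → SubseriesFamily K → ∃[ L ] MeagerCover L × (L ↣ K))
theorem15 em ac =
  -- `L` injects into the index type of every meager cover, in particular of the one built from the
  -- family on `K`.
  (λ K L (family , _) (_ , least) →
    let L′ , cover , L′↣K = meagerCover-from-subseriesFamily em ac K family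
    in L′↣K ↣-∘ least L′ cover) ,
  meagerCover-from-subseriesFamily em ac
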